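{- Let $G$ be a graph and $X,Y$ disjoint subsets of $V(G)$ such that $G$ is $X$–$Y$ normalized, and let $K\neq N(X)$ be an important $X$–$Y$ separator. Then $K$ is a compound witness (w.r.t. $X,Y$ in $G$) of rank at most the excess of $K$.
   Context: All graphs are finite, simple and undirected. $G\setminus C$ is the subgraph induced by $V(G)\setminus C$; $N(C)=(\bigcup_{v\in C}N(v))\setminus C$. For disjoint $X,Y$, an $X$–$Y$ separator is a set $K\subseteq V(G)\setminus(X\cup Y)$ such that $G\setminus K$ has no path from $X$ to $Y$; minimal means inclusion-minimal, smallest means of minimum cardinality. $NR(G,A,B)$ is the set of vertices of $G\setminus B$ not reachable from $A$ in $G\setminus B$. $K_1\ge K_2$ means $NR(G,Y,K_1)\supseteq NR(G,Y,K_2)$, and $K_1>K_2$ means strict containment. A minimal $X$–$Y$ separator $K$ is important if no $X$–$Y$ separator $K'$ satisfies $K'>K$ and $|K'|\le|K|$. The excess of an $X$–$Y$ separator $K$ is $|K|-r$ where $r$ is the minimum size of an $X$–$Y$ separator. $G$ is $X$–$Y$ normalized if $N(X)$ is the only smallest $X$–$Y$ separator. For an $X$–$Y$ separator $K$, $Pr(G,X,Y,K)$ is the graph obtained from $G\setminus(NR(G,Y,K)\setminus X)$ by making every vertex of $X$ adjacent to every vertex of $K$. In an $X$–$Y$ normalized graph, for $S\subseteq N(X)$ with no vertex of $S$ adjacent to a vertex of $Y$: the cover excess $CE(S)$ is the excess of a smallest $X$–$Y$ separator disjoint from $S$; a witness of $S$ is an $X$–$Y$ separator $K$ with $K\cap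 S=\emptyset$ and excess $CE(S)$; an important witness of $S$ is a witness that is an important $X$–$Y$ separator; there is exactly one important witness of $S$, denoted $K(S)$. Compound witness: let $G$ be $X$–$Y$ normalized, $(S_1,\dots,S_r)$ a sequence of pairwise disjoint non-empty vertex sets and $K$ an $X$–$Y$ separator. If $r=1$, $K$ is a compound witness of attribute $(S_1)$ if $S_1\subseteq N(X)$ and $K=K(S_1)$. If $r\ge2$, $K$ is a compound witness of attribute $(S_1,\dots,S_r)$ if $S_1\subseteq N(X)$ (with $K(S_1)$ defined), $S_2\cup\dots\cup S_r$ is disjoint from $N(X)$, and $K$ is a compound witness of $(S_2,\dots,S_r)$ w.r.t. $X,Y$ in the ($X$–$Y$ normalized) graph $Pr(G,X,Y,K(S_1))$. The rank of such a compound witness is $|S_1|+\dots+|S_r|$. -}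

module Defs where

open import Data.Nat using (ℕ; _+_; _≤_; _∸_)
open import Data.Bool using (Bool; true; false; _∧_; _∨_)
open import Data.Fin using (Fin)
open import Data.Fin.Subset using (Subset; _∈_; _∉_; _⊆_; ∣_∣; Nonempty)
open import Data.Vec using (lookup)
open import Data.List using (List; []; _∷_)
open import Data.List.Relation.Unary.All using (All)
open import Data.Product using (Σ; ∃; _×_; _,_)
open import Relation.Nullary using (¬_)
open import Relation.Binary.PropositionalEquality using (_≡_)
open import Function.Bundles using (_⇔_)

-- A graph on a vertex set V ⊆ Fin n, with Boolean adjacency (only
-- adjacencies between vertices of V are meaningful).
record Graph (n : ℕ) : Set where
  constructor mkGraph
  field
    V   : Subset n
    Adj : Fin n → Fin n → Bool
open Graph public

module _ {n : ℕ} where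

  IsSimple : Graph n → Set
  IsSimple G = (∀ u v → Adj G u v ≡ Adj G v u) × (∀ v → Adj G v v ≡ false)

  Edge : Graph n → Fin n → Fin n → Set
  Edge G u v = u ∈ V G × v ∈ V G × Adj G u v ≡ true

  Disjoint : Subset n → Subset n → Set
  Disjoint A B = ∀ v → v ∈ A → v ∉ B

  data Reach (G : Graph n) (B : Subset n) (u : Fin n) : Fin n → Set where
    here : u ∈ V G → u ∉ B → Reach G B u u
    step : ∀ {w v} → Reach G B u w → Edge G w v → v ∉ B → Reach G B u v

  InNR : Graph n → Subset n → Subset n → Fin n → Set
  InNR G A B v = v ∈ V G × v ∉ B × ¬ (∃ λ a → a ∈ A × Reach G B a v)

  InN : Graph n → Subset n → Fin n → Set
  InN G C v = v ∈ V G × v ∉ C × ∃ λ c → c ∈ C × Edge G c v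

  IsNbhd : Graph n → Subset n → Subset n → Set
  IsNbhd G C N = ∀ v → (v ∈ N ⇔ InN G C v)

  IsSep : Graph n → Subset n → Subset n → Subset n → Set
  IsSep G X Y K =
    K ⊆ V G × Disjoint K X × Disjoint K Y ×
    (∀ x y → x ∈ X → y ∈ Y → ¬ Reach G K x y)

  IsMinimalSep : Graph n → Subset n → Subset n → Subset n → Set
  IsMinimalSep G X Y K =
    IsSep G X Y K × (∀ K' → K' ⊆ K → IsSep G X Y K' → K' ≡ K)

  IsSmallestSep : Graph n → Subset n → Subset n → Subset n → Set
  IsSmallestSep G X Y K = IsSep G X Y K × (∀ K' → IsSep G X Y K' → ∣ K ∣ ≤ ∣ K' ∣)

  MinSepSize : Graph n → Subset n → Subset n → ℕ → Set
  MinSepSize G X Y r = ∃ (λ K → IsSmallestSep G X Y K × ∣ K ∣ ≡ r)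

  _⊒⟨_,_⟩_ : Subset n → Graph n → Subset n → Subset n → Set
  K₁ ⊒⟨ G , Y ⟩ K₂ = ∀ v → InNR G Y K₂ v → InNR G Y K₁ v

  _⊐⟨_,_⟩_ : Subset n → Graph n → Subset n → Subset n → Set
  K₁ ⊐⟨ G , Y ⟩ K₂ = K₁ ⊒⟨ G , Y ⟩ K₂ × ∃ (λ v → InNR G Y K₁ v × ¬ InNR G Y K₂ v)

  IsImportantSep : Graph n → Subset n → Subset n → Subset n → Set
  IsImportantSep G X Y K =
    IsMinimalSep G X Y K ×
    ¬ (∃ λ K' → IsSep G X Y K' × K' ⊐⟨ G , Y ⟩ K × ∣ K' ∣ ≤ ∣ K ∣)

  IsNormalized : Graph n → Subset n → Subset n → Set
  IsNormalized G X Y = ∃ λ N → IsNbhd G X N × IsSmallestSep G X Y N ×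
    (∀ K → IsSmallestSep G X Y K → K ≡ N)

  CEDefined : Graph n → Subset n → Subset n → Subset n → Set
  CEDefined G X Y S =
    (∀ s → s ∈ S → InN G X s) × (∀ s y → s ∈ S → y ∈ Y → ¬ Edge G s y)

  -- K is a witness of S: separator disjoint from S of excess CE(S), i.e.
  -- of minimum size among separators disjoint from S
  IsWitness : Graph n → Subset n → Subset n → Subset n → Subset n → Set
  IsWitness G X Y S K =
    IsSep G X Y K × Disjoint K S ×
    (∀ K' → IsSep G X Y K' → Disjoint K' S → ∣ K ∣ ≤ ∣ K' ∣)

  IsImportantWitness : Graph n → Subset n → Subset n → Subset n → Subset n → Set
  IsImportantWitness G X Y S K = IsWitness G X Y S K × IsImportantSep G X Y K

  IsPrVerts : Graph n → Subset n → Subset n → Subset n → Subset n → Set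
  IsPrVerts G X Y K V' = ∀ v → (v ∈ V' ⇔ (v ∈ V G × ¬ (InNR G Y K v × v ∉ X)))

  PrGraph : Graph n → Subset n → Subset n → Subset n → Graph n
  PrGraph G X K V' = mkGraph V' (λ u v →
    Adj G u v ∨ (lookup X u ∧ lookup K v) ∨ (lookup K u ∧ lookup X v))

  DisjAll : Subset n → List (Subset n) → Set
  DisjAll S L = All (Disjoint S) L

  data CompoundWitness (X Y : Subset n) : Graph n → List (Subset n) → Subset n → Set where
    single : ∀ {G S K} → Nonempty S → CEDefined G X Y S →
      IsImportantWitness G X Y S K → CompoundWitness X Y G (S ∷ []) K
    cons : ∀ {G S S₂ Ss K K₁ N V'} → Nonempty S → DisjAll S (S₂ ∷ Ss) →
      CEDefined G X Y S → IsImportantWitness G X Y S K₁ →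
      IsNbhd G X N → All (Disjoint N) (S₂ ∷ Ss) →
      IsPrVerts G X Y K₁ V' →
      CompoundWitness X Y (PrGraph G X K₁ V') (S₂ ∷ Ss) K →
      CompoundWitness X Y G (S ∷ S₂ ∷ Ss) K

  rank : List (Subset n) → ℕ
  rank [] = 0
  rank (S ∷ Ss) = ∣ S ∣ + rank Ss

{-# OPTIONS --safe #-}
-- Separators correspond to cuts: sets A ⊇ X with A and its boundary ∂A disjoint from Y, where a
-- separator K gives NR(K), whose boundary lies in K. The size of the boundary is submodular, so
-- among the cuts containing S of least boundary there is a largest one, B, and K(S) = ∂B.
-- Moreover, uncrossing B with NR(K) for an important K disjoint from S gives B ⊆ NR(K).
--
-- Choose S ⊆ N(X) \ K greedily: as long as K(S) contains a vertex t ∈ N(X) \ K, add t to S. By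
-- maximality of B, avoiding t as well costs at least one more vertex, so |S| never exceeds the
-- cover excess of S. When this stops, N(X) ∩ K(S) ⊆ K. Cuts A of G containing B and cuts of
-- Pr(G,X,Y,K(S)) correspond through A ↦ A ∩ V′ and A′ ↦ A′ ∪ B without increasing the boundary,
-- so K stays important in Pr, which is normalized with N(X) replaced by the larger set K(S).
-- Iterate; the excess of K drops by the cover excess of S, which is at least |S|.
module Submission where

open import Defs
open import Data.Nat using (ℕ; zero; suc; _+_; _≤_; _<_; s≤s; _<?_)
open import Data.Nat.Properties
open import Data.Nat.Induction using (<-wellFounded)
open import Data.Bool using (true; false; _∧_; _∨_)
open import Data.Bool.Properties using (∨-zeroʳ; ∨-comm; ∧-comm) renaming (_≟_ to _≟ᵇ_)
open import Data.Fin using (Fin)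
open import Data.Fin.Properties using (any?; all?)
open import Data.Fin.Subset
  using (Subset; inside; outside; _∈_; _∉_; _⊆_; _∪_; _∩_; ∁; ⁅_⁆; ⊥; ∣_∣; _⊃_; Nonempty)
open import Data.Fin.Subset.Properties
open import Data.Fin.Subset.Induction using (⊃-wellFounded)
open import Data.List using (List; []; _∷_)
open import Data.List.Relation.Unary.All as All using (All; []; _∷_)
open import Data.Product using (∃; _×_; _,_; proj₁; proj₂; map₁)
open import Data.Sum using (_⊎_; inj₁; inj₂; [_,_]′)
open import Data.Vec using (lookup; tabulate; []; _∷_)
open import Data.Vec.Properties using ([]=⇒lookup; lookup⇒[]=; lookup∘tabulate; ≡-dec)
open import Function using (_∘_; id)
open import Function.Bundles using (mk⇔; Equivalence)
open import Induction.WellFounded using (Acc; acc)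
open import Relation.Nullary using (¬_; Dec; yes; no; does; contradiction)
open import Relation.Nullary.Decidable
  using (map′; _×-dec_; _→-dec_; ¬?; dec-true; decidable-stable)
open import Relation.Unary using (Decidable)
open import Relation.Binary.PropositionalEquality
  using (_≡_; _≢_; refl; sym; trans; cong; cong₂; subst; subst₂)

open Equivalence using (to; from)

private variable
  n : ℕ

-- Finite subsets

module _ {P : Fin n → Set} (P? : Decidable P) where

  opaque
    ⟪_⟫ : Subset n
    ⟪_⟫ = tabulate (does ∘ P?)

    ∈⟪⟫⁺ : ∀ {v} → P v → v ∈ ⟪_⟫
    ∈⟪⟫⁺ {v} p =
      lookup⇒[]= v _ (trans (lookup∘tabulate (does ∘ P?) v) (dec-true (P? v) p))

    ∈⟪⟫⁻ : ∀ {v} → v ∈ ⟪_⟫ → P v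
    ∈⟪⟫⁻ {v} v∈ with P? v | trans (sym (lookup∘tabulate (does ∘ P?) v)) ([]=⇒lookup v∈)
    ... | yes p | _ = p
    ... | no _  | ()

∣p∪q∣+∣p∩q∣≡∣p∣+∣q∣ : (p q : Subset n) → ∣ p ∪ q ∣ + ∣ p ∩ q ∣ ≡ ∣ p ∣ + ∣ q ∣
∣p∪q∣+∣p∩q∣≡∣p∣+∣q∣ [] [] = refl
∣p∪q∣+∣p∩q∣≡∣p∣+∣q∣ (outside ∷ p) (outside ∷ q) = ∣p∪q∣+∣p∩q∣≡∣p∣+∣q∣ p q
∣p∪q∣+∣p∩q∣≡∣p∣+∣q∣ (inside ∷ p) (outside ∷ q) = cong suc (∣p∪q∣+∣p∩q∣≡∣p∣+∣q∣ p q)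
∣p∪q∣+∣p∩q∣≡∣p∣+∣q∣ (outside ∷ p) (inside ∷ q) =
  trans (cong suc (∣p∪q∣+∣p∩q∣≡∣p∣+∣q∣ p q)) (sym (+-suc ∣ p ∣ ∣ q ∣))
∣p∪q∣+∣p∩q∣≡∣p∣+∣q∣ (inside ∷ p) (inside ∷ q) =
  cong suc (trans (+-suc _ ∣ p ∩ q ∣)
    (trans (cong suc (∣p∪q∣+∣p∩q∣≡∣p∣+∣q∣ p q)) (sym (+-suc ∣ p ∣ ∣ q ∣))))

∣p∪⁅x⁆∣≤1+∣p∣ : (p : Subset n) (x : Fin n) → ∣ p ∪ ⁅ x ⁆ ∣ ≤ suc ∣ p ∣
∣p∪⁅x⁆∣≤1+∣p∣ p x = begin
  ∣ p ∪ ⁅ x ⁆ ∣                    ≤⟨ m≤m+n _ _ ⟩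
  ∣ p ∪ ⁅ x ⁆ ∣ + ∣ p ∩ ⁅ x ⁆ ∣    ≡⟨ ∣p∪q∣+∣p∩q∣≡∣p∣+∣q∣ p ⁅ x ⁆ ⟩
  ∣ p ∣ + ∣ ⁅ x ⁆ ∣                ≡⟨ cong (∣ p ∣ +_) (∣⁅x⁆∣≡1 x) ⟩
  ∣ p ∣ + 1                        ≡⟨ +-comm ∣ p ∣ 1 ⟩
  suc ∣ p ∣                        ∎
  where open ≤-Reasoning

p⊆q∧∣q∣≤∣p∣⇒q⊆p : {p q : Subset n} → p ⊆ q → ∣ q ∣ ≤ ∣ p ∣ → q ⊆ p
p⊆q∧∣q∣≤∣p∣⇒q⊆p {p = p} p⊆q ∣q∣≤∣p∣ {x} x∈q with x ∈? p
... | yes x∈p = x∈p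
... | no  x∉p =
  contradiction (p⊂q⇒∣p∣<∣q∣ (p⊆q , x , x∈q , x∉p)) (≤⇒≯ ∣q∣≤∣p∣)

∪-lub : {p q r : Subset n} → p ⊆ r → q ⊆ r → p ∪ q ⊆ r
∪-lub {p = p} {q} p⊆r q⊆r = [ p⊆r , q⊆r ]′ ∘ x∈p∪q⁻ p q

∩-glb : {p q r : Subset n} → r ⊆ p → r ⊆ q → r ⊆ p ∩ q
∩-glb r⊆p r⊆q x∈r = x∈p∩q⁺ (r⊆p x∈r , r⊆q x∈r)

disjoint? : (A B : Subset n) → Dec (Disjoint A B)
disjoint? A B = all? λ v → (v ∈? A) →-dec ¬? (v ∈? B)

argmin : {P : Subset n → Set} → Decidable P → (f : Subset n → ℕ) → ∃ P →
  ∃ λ A → P A × (∀ C → P C → f A ≤ f C)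
argmin {n} {P} P? f (A₀ , p₀) = go A₀ p₀ (<-wellFounded (f A₀))
  where
  go : ∀ A → P A → Acc _<_ (f A) → ∃ λ A → P A × (∀ C → P C → f A ≤ f C)
  go A p (acc rs) with anySubset? (λ C → P? C ×-dec (f C <? f A))
  ... | yes (C , q , fC<fA) = go C q (rs fC<fA)
  ... | no ¬∃ = A , p , λ C q → ≮⇒≥ λ fC<fA → ¬∃ (C , q , fC<fA)

-- Boundaries

module Boundary {n : ℕ} (G : Graph n) where

  edge? : ∀ u v → Dec (Edge G u v)
  edge? u v = (u ∈? V G) ×-dec (v ∈? V G) ×-dec (Adj G u v ≟ᵇ true)

  inN? : ∀ A → Decidable (InN G A)
  inN? A v = (v ∈? V G) ×-dec ¬? (v ∈? A) ×-dec any? (λ c → (c ∈? A) ×-dec edge? c v)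

  opaque
    ∂ : Subset n → Subset n
    ∂ A = ⟪ inN? A ⟫

    ∈∂⁺ : ∀ {A v} → InN G A v → v ∈ ∂ A
    ∈∂⁺ = ∈⟪⟫⁺ (inN? _)

    ∈∂⁻ : ∀ {A v} → v ∈ ∂ A → InN G A v
    ∈∂⁻ = ∈⟪⟫⁻ (inN? _)

  ∂-spread : ∀ {A c v} → c ∈ A → Edge G c v → v ∈ A ⊎ v ∈ ∂ A
  ∂-spread {A} {c} {v} c∈A e with v ∈? A
  ... | yes v∈A = inj₁ v∈A
  ... | no  v∉A = inj₂ (∈∂⁺ (proj₁ (proj₂ e) , v∉A , c , c∈A , e))

  ∂⊆V : ∀ {A} → ∂ A ⊆ V G
  ∂⊆V v∈ = proj₁ (∈∂⁻ v∈)

  ∈∂⇒∉ : ∀ {A v} → v ∈ ∂ A → v ∉ A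
  ∈∂⇒∉ v∈ = proj₁ (proj₂ (∈∂⁻ v∈))

  ∂-∪⊆ : ∀ A B → ∂ (A ∪ B) ⊆ ∂ A ∪ ∂ B
  ∂-∪⊆ A B v∈ with ∈∂⁻ v∈
  ... | v∈V , v∉ , c , c∈ , e with x∈p∪q⁻ A B c∈
  ... | inj₁ c∈A = x∈p∪q⁺ (inj₁ (∈∂⁺ (v∈V , v∉ ∘ x∈p∪q⁺ ∘ inj₁ , c , c∈A , e)))
  ... | inj₂ c∈B = x∈p∪q⁺ (inj₂ (∈∂⁺ (v∈V , v∉ ∘ x∈p∪q⁺ ∘ inj₂ , c , c∈B , e)))

  ∂-∩⊆ : ∀ A B → ∂ (A ∩ B) ⊆ ∂ A ∪ ∂ B
  ∂-∩⊆ A B {v} v∈ with ∈∂⁻ v∈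
  ... | v∈V , v∉ , c , c∈ , e with x∈p∩q⁻ A B c∈
  ... | c∈A , c∈B with ∂-spread c∈A e | ∂-spread c∈B e
  ... | inj₂ v∈∂A | _ = x∈p∪q⁺ (inj₁ v∈∂A)
  ... | inj₁ _    | inj₂ v∈∂B = x∈p∪q⁺ (inj₂ v∈∂B)
  ... | inj₁ v∈A  | inj₁ v∈B = contradiction (x∈p∩q⁺ (v∈A , v∈B)) v∉

  -- A vertex in both boundaries lies outside `A ∪ B` and has a neighbour in `A ∩ B`.
  ∂-∪∩⊆ : ∀ A B → ∂ (A ∪ B) ∩ ∂ (A ∩ B) ⊆ ∂ A ∩ ∂ B
  ∂-∪∩⊆ A B v∈ with x∈p∩q⁻ _ _ v∈
  ... | v∈∪ , v∈∩ with ∈∂⁻ v∈∪ | ∈∂⁻ v∈∩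
  ... | v∈V , v∉ , _ | _ , _ , c , c∈ , e with x∈p∩q⁻ A B c∈
  ... | c∈A , c∈B = x∈p∩q⁺
    ( ∈∂⁺ (v∈V , v∉ ∘ x∈p∪q⁺ ∘ inj₁ , c , c∈A , e)
    , ∈∂⁺ (v∈V , v∉ ∘ x∈p∪q⁺ ∘ inj₂ , c , c∈B , e))

  ∂-submodular : ∀ A B → ∣ ∂ (A ∪ B) ∣ + ∣ ∂ (A ∩ B) ∣ ≤ ∣ ∂ A ∣ + ∣ ∂ B ∣
  ∂-submodular A B = begin
    ∣ ∂∪ ∣ + ∣ ∂∩ ∣              ≡⟨ ∣p∪q∣+∣p∩q∣≡∣p∣+∣q∣ ∂∪ ∂∩ ⟨
    ∣ ∂∪ ∪ ∂∩ ∣ + ∣ ∂∪ ∩ ∂∩ ∣    ≤⟨ +-mono-≤ (p⊆q⇒∣p∣≤∣q∣ (∪-lub (∂-∪⊆ A B) (∂-∩⊆ A B)))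
                                            (p⊆q⇒∣p∣≤∣q∣ (∂-∪∩⊆ A B)) ⟩
    ∣ ∂ A ∪ ∂ B ∣ + ∣ ∂ A ∩ ∂ B ∣ ≡⟨ ∣p∪q∣+∣p∩q∣≡∣p∣+∣q∣ (∂ A) (∂ B) ⟩
    ∣ ∂ A ∣ + ∣ ∂ B ∣            ∎
    where
    open ≤-Reasoning
    ∂∪ = ∂ (A ∪ B)
    ∂∩ = ∂ (A ∩ B)

  -- Makes reachability decidable: while an edge leads from `T` to a new vertex outside `K`, that
  -- vertex joins `T`. Finiteness ends this at a closed set of reachable vertices.
  saturate : ∀ {K u} T → Acc _⊃_ T → (∀ {v} → v ∈ T → Reach G K u v) →
    ∃ λ T′ → T ⊆ T′ × (∀ {v} → v ∈ T′ → Reach G K u v) ×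
      (∀ {w v} → w ∈ T′ → Edge G w v → v ∉ K → v ∈ T′)
  saturate {K} {u} T (acc rs) sound
    with any? (λ v → ¬? (v ∈? T) ×-dec ¬? (v ∈? K) ×-dec
                     any? (λ w → (w ∈? T) ×-dec edge? w v))
  ... | no ¬∃ = T , id , sound , λ {w} {v} w∈T e v∉K →
    decidable-stable (v ∈? T) λ v∉T → ¬∃ (v , v∉T , v∉K , w , w∈T , e)
  ... | yes (v , v∉T , v∉K , w , w∈T , e) =
    let T′ , ⊆T′ , sound′ , closed = saturate (T ∪ ⁅ v ⁆)
          (rs (p⊆p∪q ⁅ v ⁆ , v , x∈p∪q⁺ (inj₂ (x∈⁅x⁆ v)) , v∉T)) sound⁺
    in T′ , ⊆T′ ∘ p⊆p∪q ⁅ v ⁆ , sound′ , closed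
    where
    sound⁺ : ∀ {z} → z ∈ T ∪ ⁅ v ⁆ → Reach G K u z
    sound⁺ z∈ with x∈p∪q⁻ T ⁅ v ⁆ z∈
    ... | inj₁ z∈T = sound z∈T
    ... | inj₂ z∈v with refl ← x∈⁅y⁆⇒x≡y v z∈v = step (sound w∈T) e v∉K

  reach-start : ∀ {K u v} → Reach G K u v → u ∈ V G × u ∉ K
  reach-start (here u∈V u∉K) = u∈V , u∉K
  reach-start (step p _ _)   = reach-start p

  reach-closed : ∀ {K A u v} → ∂ A ⊆ K → u ∈ A → Reach G K u v → v ∈ A
  reach-closed ∂⊆K u∈A (here _ _)     = u∈A
  reach-closed ∂⊆K u∈A (step p e v∉K) with ∂-spread (reach-closed ∂⊆K u∈A p) e
  ... | inj₁ v∈A  = v∈A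
  ... | inj₂ v∈∂A = contradiction (∂⊆K v∈∂A) v∉K

  reach? : ∀ K u v → Dec (Reach G K u v)
  reach? K u v with (u ∈? V G) ×-dec ¬? (u ∈? K)
  ... | no ¬p = no (¬p ∘ reach-start)
  ... | yes (u∈V , u∉K)
    with saturate ⁅ u ⁆ (⊃-wellFounded ⁅ u ⁆)
           (λ z∈ → subst (Reach G K u) (sym (x∈⁅y⁆⇒x≡y u z∈)) (here u∈V u∉K))
  ... | T , ⊆T , sound , closed = map′ sound (complete (⊆T (x∈⁅x⁆ u))) (v ∈? T)
    where
    complete : ∀ {z} → u ∈ T → Reach G K u z → z ∈ T
    complete u∈T (here _ _)     = u∈T
    complete u∈T (step p e v∉K) = closed (complete u∈T p) e v∉K

  module _ (symm : ∀ u v → Adj G u v ≡ Adj G v u) where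

    edge-sym : ∀ {u v} → Edge G u v → Edge G v u
    edge-sym {u} {v} (u∈V , v∈V , a) = v∈V , u∈V , trans (symm v u) a

    reach-sym : ∀ {K u v} → Reach G K u v → Reach G K v u
    reach-sym (here u∈V u∉K) = here u∈V u∉K
    -- Paths grow at the far end, so the last edge has to be put in front of the reversed rest.
    reach-sym (step {w} {v} p e v∉K) = prepend (reach-sym p)
      where
      prepend : ∀ {z} → Reach G _ w z → Reach G _ v z
      prepend (here _ w∉K)      = step (here (proj₁ (proj₂ e)) v∉K) (edge-sym e) w∉K
      prepend (step q e′ z∉K) = step (prepend q) e′ z∉K

-- Cuts and separators

module Cuts {n : ℕ} (X Y : Subset n) (G : Graph n)
            (symm : ∀ u v → Adj G u v ≡ Adj G v u) (X⊆V : X ⊆ V G) where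

  open Boundary G public

  record Cut (A : Subset n) : Set where
    field
      X⊆A   : X ⊆ A
      A⊆V   : A ⊆ V G
      A∩Y≡∅ : Disjoint A Y
      ∂∩Y≡∅ : Disjoint (∂ A) Y
  open Cut public

  cut? : Decidable Cut
  cut? A = map′ pack (λ c → X⊆A c , A⊆V c , A∩Y≡∅ c , ∂∩Y≡∅ c)
    ((X ⊆? A) ×-dec (A ⊆? V G) ×-dec disjoint? A Y ×-dec disjoint? (∂ A) Y)
    where
    pack : X ⊆ A × A ⊆ V G × Disjoint A Y × Disjoint (∂ A) Y → Cut A
    pack (p , q , r , s) = record { X⊆A = p ; A⊆V = q ; A∩Y≡∅ = r ; ∂∩Y≡∅ = s }

  cut-∪ : ∀ {A B} → Cut A → Cut B → Cut (A ∪ B)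
  cut-∪ {A} {B} a b = record
    { X⊆A = p⊆p∪q B ∘ X⊆A a
    ; A⊆V = ∪-lub (A⊆V a) (A⊆V b)
    ; A∩Y≡∅ = λ v → [ A∩Y≡∅ a v , A∩Y≡∅ b v ]′ ∘ x∈p∪q⁻ A B
    ; ∂∩Y≡∅ = λ v → [ ∂∩Y≡∅ a v , ∂∩Y≡∅ b v ]′ ∘ x∈p∪q⁻ (∂ A) (∂ B) ∘ ∂-∪⊆ A B
    }

  cut-∩ : ∀ {A B} → Cut A → Cut B → Cut (A ∩ B)
  cut-∩ {A} {B} a b = record
    { X⊆A = ∩-glb (X⊆A a) (X⊆A b)
    ; A⊆V = A⊆V a ∘ p∩q⊆p A B
    ; A∩Y≡∅ = λ v → A∩Y≡∅ a v ∘ p∩q⊆p A B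
    ; ∂∩Y≡∅ = λ v → [ ∂∩Y≡∅ a v , ∂∩Y≡∅ b v ]′ ∘ x∈p∪q⁻ (∂ A) (∂ B) ∘ ∂-∩⊆ A B
    }

  inNR? : ∀ K → Decidable (InNR G Y K)
  inNR? K v = (v ∈? V G) ×-dec ¬? (v ∈? K) ×-dec
    ¬? (any? λ y → (y ∈? Y) ×-dec reach? K y v)

  opaque
    NR : Subset n → Subset n
    NR K = ⟪ inNR? K ⟫

    ∈NR⁺ : ∀ {K v} → InNR G Y K v → v ∈ NR K
    ∈NR⁺ = ∈⟪⟫⁺ (inNR? _)

    ∈NR⁻ : ∀ {K v} → v ∈ NR K → InNR G Y K v
    ∈NR⁻ = ∈⟪⟫⁻ (inNR? _)

  -- If `Y` reached a boundary vertex outside `K`, it would also reach that vertex's neighbour `c`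
  -- in `NR K`.
  ∂NR⊆ : ∀ K → ∂ (NR K) ⊆ K
  ∂NR⊆ K {v} v∈ with ∈∂⁻ v∈ | v ∈? K
  ... | _ | yes v∈K = v∈K
  ... | v∈V , v∉ , c , c∈ , e | no v∉K =
    let _ , c∉K , unreach = ∈NR⁻ c∈
    in contradiction
      (∈NR⁺ (v∈V , v∉K , λ (y , y∈Y , p) → unreach (y , y∈Y , step p (edge-sym symm e) c∉K)))
      v∉

  ⊆NR∂ : ∀ {A} → Cut A → A ⊆ NR (∂ A)
  ⊆NR∂ a {v} v∈A = ∈NR⁺ (A⊆V a v∈A , (λ v∈∂ → ∈∂⇒∉ v∈∂ v∈A) , λ (y , y∈Y , p) →
    A∩Y≡∅ a y (reach-closed id v∈A (reach-sym symm p)) y∈Y)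

  cut⇒sep : ∀ {A K} → Cut A → ∂ A ⊆ K → K ⊆ V G → Disjoint K X → Disjoint K Y → IsSep G X Y K
  cut⇒sep a ∂⊆K K⊆V K∩X K∩Y = K⊆V , K∩X , K∩Y , λ x y x∈X y∈Y p →
    A∩Y≡∅ a y (reach-closed ∂⊆K (X⊆A a x∈X) p) y∈Y

  ∂-sep : ∀ {A} → Cut A → IsSep G X Y (∂ A)
  ∂-sep a = cut⇒sep a id ∂⊆V (λ v v∈∂ v∈X → ∈∂⇒∉ v∈∂ (X⊆A a v∈X)) (∂∩Y≡∅ a)

  -- Counterpart for cuts of the clause that no separator beats an important one; minimality is
  -- treated apart.
  MaxCut : Subset n → Set
  MaxCut A = Cut A × (∀ {C} → Cut C → A ⊆ C → ∣ ∂ C ∣ ≤ ∣ ∂ A ∣ → C ⊆ A)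

  sep⇒cut : ∀ {K} → IsSep G X Y K → Cut (NR K)
  sep⇒cut {K} (_ , K∩X , K∩Y , unreach) = record
    { X⊆A = λ {x} x∈X → ∈NR⁺ (X⊆V x∈X , (λ x∈K → K∩X x x∈K x∈X) ,
        λ (y , y∈Y , p) → unreach x y x∈X y∈Y (reach-sym symm p))
    ; A⊆V = proj₁ ∘ ∈NR⁻
    ; A∩Y≡∅ = λ y y∈NR y∈Y → let y∈V , y∉K , unreached = ∈NR⁻ y∈NR in
        unreached (y , y∈Y , here y∈V y∉K)
    ; ∂∩Y≡∅ = λ y → K∩Y y ∘ ∂NR⊆ K
    }

  important⇒∂NR≡ : ∀ {K} → IsImportantSep G X Y K → ∂ (NR K) ≡ K
  important⇒∂NR≡ {K} ((sep , minimal) , _) =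
    minimal (∂ (NR K)) (∂NR⊆ K) (∂-sep (sep⇒cut sep))

  -- A strictly larger cut `C` with no larger boundary would yield the separator `∂ C`, whose `NR`
  -- contains `C`, and this would beat `K`.
  important⇒maxCut : ∀ {K} → IsImportantSep G X Y K → MaxCut (NR K)
  important⇒maxCut {K} imp@((sep , _) , unbeaten) = sep⇒cut sep , λ {C} c NR⊆C ∂C≤ {v} v∈C →
    decidable-stable (v ∈? NR K) λ v∉NR → unbeaten
      ( ∂ C , ∂-sep c
      , ((λ w → ∈NR⁻ ∘ ⊆NR∂ c ∘ NR⊆C ∘ ∈NR⁺) , v , ∈NR⁻ (⊆NR∂ c v∈C) , v∉NR ∘ ∈NR⁺)
      , subst (λ K → ∣ ∂ C ∣ ≤ ∣ K ∣) (important⇒∂NR≡ imp) ∂C≤ )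

  -- For a rival `K` of `∂ A`, `NR K` is a cut around `A` with boundary inside `K`; maximality
  -- forces it back into `A`.
  maxCut⇒important : ∀ {A} → MaxCut A → (∀ K → K ⊆ ∂ A → IsSep G X Y K → K ≡ ∂ A) →
    IsImportantSep G X Y (∂ A)
  maxCut⇒important {A} (a , maximal) minimal = (∂-sep a , minimal) ,
    λ (K , sep , (K⊒∂A , v , v∈NRK , v∉NR∂A) , K≤) →
      let A⊆NRK = λ {w} w∈A → ∈NR⁺ (K⊒∂A w (∈NR⁻ (⊆NR∂ a w∈A)))
          ∂≤ = ≤-trans (p⊆q⇒∣p∣≤∣q∣ (∂NR⊆ K)) K≤
      in v∉NR∂A (∈NR⁻ (⊆NR∂ a (maximal (sep⇒cut sep) A⊆NRK ∂≤ (∈NR⁺ v∈NRK))))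

  neighbour∈NR : ∀ {K s} → IsSep G X Y K → s ∈ ∂ X → s ∉ K → s ∈ NR K
  neighbour∈NR {K} sep s∈∂X s∉K =
    let _ , _ , x , x∈X , e = ∈∂⁻ s∈∂X
    in [ id , (λ s∈∂ → contradiction (∂NR⊆ K s∈∂) s∉K) ]′
         (∂-spread (X⊆A (sep⇒cut sep) x∈X) e)

  -- Tight cuts and uncrossing

  record Tight (S B : Subset n) : Set where
    field
      maxCut : MaxCut B
      S⊆B    : S ⊆ B
      least  : ∀ {C} → Cut C → S ⊆ C → ∣ ∂ B ∣ ≤ ∣ ∂ C ∣
    cut = proj₁ maxCut
    greatest = proj₂ maxCut

  tight-exists : ∀ S {A} → Cut A → S ⊆ A → ∃ (Tight S)
  tight-exists S {A} a S⊆A =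
    let P? = λ C → cut? C ×-dec (S ⊆? C)
        B₀ , p₀ , least₀ = argmin P? (∣_∣ ∘ ∂) (A , a , S⊆A)
        -- Minimizing the complement picks a largest cut among those of least boundary.
        B , ((b , S⊆B) , ∂B≤) , larger =
          argmin (λ C → P? C ×-dec (∣ ∂ C ∣ ≤? ∣ ∂ B₀ ∣)) (∣_∣ ∘ ∁) (B₀ , p₀ , ≤-refl)
    in B , record
      { maxCut = b , λ {C} c B⊆C ∂C≤ {v} v∈C → decidable-stable (v ∈? B) λ v∉B →
          <⇒≱ (p⊂q⇒∣p∣<∣q∣ (p⊂q⇒∁p⊃∁q (B⊆C , v , v∈C , v∉B)))
              (larger C ((c , B⊆C ∘ S⊆B) , ≤-trans ∂C≤ ∂B≤))
      ; S⊆B = S⊆B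
      ; least = λ {C} c S⊆C → ≤-trans ∂B≤ (least₀ C (c , S⊆C))
      }

  -- The cut `A ∩ B` still contains `S`, so its boundary is at least that of `B`; submodularity
  -- leaves at most `∣ ∂ A ∣` for the union.
  tight-uncross : ∀ {S A B} → Tight S B → Cut A → S ⊆ A → ∣ ∂ (A ∪ B) ∣ ≤ ∣ ∂ A ∣
  tight-uncross {S} {A} {B} t a S⊆A = +-cancelʳ-≤ ∣ ∂ B ∣ _ _ (begin
    ∣ ∂ (A ∪ B) ∣ + ∣ ∂ B ∣          ≤⟨ +-monoʳ-≤ ∣ ∂ (A ∪ B) ∣
                                        (least (cut-∩ a cut) (∩-glb S⊆A S⊆B)) ⟩
    ∣ ∂ (A ∪ B) ∣ + ∣ ∂ (A ∩ B) ∣    ≤⟨ ∂-submodular A B ⟩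
    ∣ ∂ A ∣ + ∣ ∂ B ∣                ∎)
    where
    open ≤-Reasoning
    open Tight t

  tight⊆maxCut : ∀ {S A B} → Tight S B → MaxCut A → S ⊆ A → B ⊆ A
  tight⊆maxCut {B = B} t (a , maximal) S⊆A =
    maximal (cut-∪ a (Tight.cut t)) (p⊆p∪q B) (tight-uncross t a S⊆A) ∘ q⊆p∪q _ B

  -- `A` shows that some cut contains the enlarged set. Without growth, `B′ ∪ B` would be a cut with
  -- boundary no larger than that of `B`, hence inside `B`; but `t` lies in `B′` and not in `B`.
  tight-extend : ∀ {S B A t} → Tight S B → t ∈ ∂ B → Cut A → S ∪ ⁅ t ⁆ ⊆ A →
    ∃ λ B′ → Tight (S ∪ ⁅ t ⁆) B′ × ∣ ∂ B ∣ < ∣ ∂ B′ ∣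
  tight-extend {S} {B} {A} {t} τ t∈∂B a S⁺⊆A =
    let B′ , τ′ = tight-exists (S ∪ ⁅ t ⁆) a S⁺⊆A in B′ , τ′ , ≰⇒> (grows τ′)
    where
    open Tight τ
    grows : ∀ {B′} → Tight (S ∪ ⁅ t ⁆) B′ → ¬ ∣ ∂ B′ ∣ ≤ ∣ ∂ B ∣
    grows {B′} τ′ ∂B′≤∂B = ∈∂⇒∉ t∈∂B (B′∪B⊆B (p⊆p∪q B (S⁺⊆B′ (x∈p∪q⁺ (inj₂ (x∈⁅x⁆ t))))))
      where
      open Tight τ′ using () renaming (cut to cut′; S⊆B to S⁺⊆B′)
      B′∪B⊆B : B′ ∪ B ⊆ B
      B′∪B⊆B = greatest (cut-∪ cut′ cut) (q⊆p∪q B′ B)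
        (≤-trans (tight-uncross τ cut′ (S⁺⊆B′ ∘ p⊆p∪q ⁅ t ⁆)) ∂B′≤∂B)

  module _ {S B} (τ : Tight S B) where

    open Tight τ

    tight-least-sep : ∀ {K} → IsSep G X Y K → S ⊆ NR K → ∣ ∂ B ∣ ≤ ∣ K ∣
    tight-least-sep {K} sep S⊆NR =
      ≤-trans (least (sep⇒cut sep) S⊆NR) (p⊆q⇒∣p∣≤∣q∣ (∂NR⊆ K))

    -- With `⊆NR∂` this gives `NR (∂ B) = B`, so projecting along `∂ B` deletes exactly the vertices
    -- of `B` outside `X`.
    tight-NR⊆ : NR (∂ B) ⊆ B
    tight-NR⊆ = greatest (sep⇒cut (∂-sep cut)) (⊆NR∂ cut) (p⊆q⇒∣p∣≤∣q∣ (∂NR⊆ (∂ B)))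

    -- Neighbours of `X` outside a separator lie in its `NR`, so separators disjoint from `S` yield
    -- cuts containing `S`. A separator inside `∂ B` also avoids `S`, hence is as large as `∂ B`;
    -- this gives minimality.
    tight⇒importantWitness : S ⊆ ∂ X → IsImportantWitness G X Y S (∂ B)
    tight⇒importantWitness S⊆∂X =
      (∂-sep cut , (λ v v∈∂ → ∈∂⇒∉ v∈∂ ∘ S⊆B) , λ K sep K∩S → least-disjoint sep K∩S) ,
      maxCut⇒important maxCut λ K K⊆∂ sep → ⊆-antisym K⊆∂
        (p⊆q∧∣q∣≤∣p∣⇒q⊆p K⊆∂ (least-disjoint sep λ v v∈K → ∈∂⇒∉ (K⊆∂ v∈K) ∘ S⊆B))
      where
      least-disjoint : ∀ {K} → IsSep G X Y K → Disjoint K S → ∣ ∂ B ∣ ≤ ∣ K ∣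
      least-disjoint sep K∩S = tight-least-sep sep λ {s} s∈S →
        neighbour∈NR sep (S⊆∂X s∈S) (λ s∈K → K∩S s s∈K s∈S)

-- The graph Pr

adj-cases : ∀ a b c d {e} → a ∨ (b ∧ c) ∨ (d ∧ e) ≡ true →
  a ≡ true ⊎ (b ≡ true × c ≡ true) ⊎ e ≡ true
adj-cases true  _     _     _    _ = inj₁ refl
adj-cases false true  true  _    _ = inj₂ (inj₁ (refl , refl))
adj-cases false true  false true p = inj₂ (inj₂ p)
adj-cases false false _     true p = inj₂ (inj₂ p)

module Projection {n : ℕ} (X Y : Subset n) (G : Graph n)
         (symm : ∀ u v → Adj G u v ≡ Adj G v u) (X⊆V : X ⊆ V G)
         {S B x₀} (τ : Cuts.Tight X Y G symm X⊆V S B) (x₀∈X : x₀ ∈ X) where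

  open Cuts X Y G symm X⊆V
  open Tight τ

  prVert? : Decidable (λ v → v ∈ V G × ¬ (InNR G Y (∂ B) v × v ∉ X))
  prVert? v = (v ∈? V G) ×-dec ¬? (inNR? (∂ B) v ×-dec ¬? (v ∈? X))

  opaque
    V′ : Subset n
    V′ = ⟪ prVert? ⟫

    isPrVerts : IsPrVerts G X Y (∂ B) V′
    isPrVerts v = mk⇔ (∈⟪⟫⁻ prVert?) (∈⟪⟫⁺ prVert?)

    V′⊆V : V′ ⊆ V G
    V′⊆V = proj₁ ∘ ∈⟪⟫⁻ prVert?

    X⊆V′ : X ⊆ V′
    X⊆V′ x∈X = ∈⟪⟫⁺ prVert? (X⊆V x∈X , λ (_ , x∉X) → x∉X x∈X)

    ∉B⇒∈V′ : ∀ {v} → v ∈ V G → v ∉ B → v ∈ V′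
    ∉B⇒∈V′ v∈V v∉B = ∈⟪⟫⁺ prVert? (v∈V , λ (nr , _) → v∉B (tight-NR⊆ τ (∈NR⁺ nr)))

    ∈V′⇒∉B : ∀ {v} → v ∈ V′ → v ∉ X → v ∉ B
    ∈V′⇒∉B v∈V′ v∉X v∈B = proj₂ (∈⟪⟫⁻ prVert? v∈V′) (∈NR⁻ (⊆NR∂ cut v∈B) , v∉X)

    ∂B⊆V′ : ∂ B ⊆ V′
    ∂B⊆V′ v∈∂ = ∉B⇒∈V′ (∂⊆V v∈∂) (∈∂⇒∉ v∈∂)

  G′ : Graph n
  G′ = PrGraph G X (∂ B) V′

  symm′ : ∀ u v → Adj G′ u v ≡ Adj G′ v u
  symm′ u v = cong₂ _∨_ (symm u v) (trans
    (∨-comm (lookup X u ∧ lookup (∂ B) v) _)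
    (cong₂ _∨_ (∧-comm (lookup (∂ B) u) _) (∧-comm (lookup X u) _)))

  module C′ = Cuts X Y G′ symm′ X⊆V′

  edge⇒edge′ : ∀ {u v} → u ∈ V′ → v ∈ V′ → Edge G u v → Edge G′ u v
  edge⇒edge′ u∈ v∈ (_ , _ , a) rewrite a = u∈ , v∈ , refl

  new-edge : ∀ {x k} → x ∈ X → k ∈ ∂ B → Edge G′ x k
  new-edge {x} {k} x∈X k∈∂ = X⊆V′ x∈X , ∂B⊆V′ k∈∂ ,
    trans (cong (λ b → Adj G x k ∨ b ∨ (lookup (∂ B) x ∧ lookup X k))
            (cong₂ _∧_ ([]=⇒lookup x∈X) ([]=⇒lookup k∈∂)))
          (∨-zeroʳ (Adj G x k))

  -- For an added edge into `X` it suffices to know its end, which lies on no boundary of a set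
  -- containing `X`.
  edge′⁻ : ∀ {u v} → Edge G′ u v → Edge G u v ⊎ (u ∈ X × v ∈ ∂ B) ⊎ v ∈ X
  edge′⁻ {u} {v} (u∈ , v∈ , a)
    with adj-cases (Adj G u v) (lookup X u) (lookup (∂ B) v) (lookup (∂ B) u) a
  ... | inj₁ adj               = inj₁ (V′⊆V u∈ , V′⊆V v∈ , adj)
  ... | inj₂ (inj₁ (u∈X , v∈∂)) = inj₂ (inj₁ (lookup⇒[]= u X u∈X , lookup⇒[]= v (∂ B) v∈∂))
  ... | inj₂ (inj₂ v∈X)         = inj₂ (inj₂ (lookup⇒[]= v X v∈X))

  -- The added edges at `x₀` reach all of `∂ B`. Conversely, an old edge from `X`, a part of `B`,
  -- ends in `B` or on `∂ B`, and no vertex of `B` outside `X` survives.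
  ∂B-nbhd : IsNbhd G′ X (∂ B)
  ∂B-nbhd v = mk⇔
    (λ v∈∂ → ∂B⊆V′ v∈∂ , (λ v∈X → ∈∂⇒∉ v∈∂ (X⊆A cut v∈X)) , x₀ , x₀∈X , new-edge x₀∈X v∈∂)
    (λ (v∈V′ , v∉X , x , x∈X , e) → hit v∈V′ v∉X x∈X (edge′⁻ e))
    where
    hit : ∀ {x} → v ∈ V′ → v ∉ X → x ∈ X → Edge G x v ⊎ (x ∈ X × v ∈ ∂ B) ⊎ v ∈ X → v ∈ ∂ B
    hit v∈V′ v∉X x∈X (inj₂ (inj₁ (_ , v∈∂))) = v∈∂
    hit v∈V′ v∉X x∈X (inj₂ (inj₂ v∈X))       = contradiction v∈X v∉X
    hit v∈V′ v∉X x∈X (inj₁ e) = [ (λ v∈B → contradiction v∈B (∈V′⇒∉B v∈V′ v∉X)) , id ]′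
      (∂-spread (X⊆A cut x∈X) e)

  -- A boundary vertex adjacent to `B` lies on `∂ B`, so it is adjacent in `G′` to `x₀`, a vertex of
  -- `A`.
  ∂-lift⊆ : ∀ {A} → C′.Cut A → ∂ (A ∪ B) ⊆ C′.∂ A
  ∂-lift⊆ {A} a {v} v∈ with ∈∂⁻ v∈
  ... | v∈V , v∉ , c , c∈ , e = go
    where
    v∉A : v ∉ A
    v∉A = v∉ ∘ x∈p∪q⁺ ∘ inj₁
    v∈V′ : v ∈ V′
    v∈V′ = ∉B⇒∈V′ v∈V (v∉ ∘ x∈p∪q⁺ ∘ inj₂)
    go : v ∈ C′.∂ A
    go with x∈p∪q⁻ A B c∈
    ... | inj₁ c∈A = C′.∈∂⁺ (v∈V′ , v∉A , c , c∈A , edge⇒edge′ (C′.A⊆V a c∈A) v∈V′ e)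
    ... | inj₂ c∈B = C′.∈∂⁺ (v∈V′ , v∉A , x₀ , C′.X⊆A a x₀∈X ,
      new-edge x₀∈X (∈∂⁺ (v∈V , v∉ ∘ x∈p∪q⁺ ∘ inj₂ , c , c∈B , e)))

  lift : ∀ {A} → C′.Cut A → Cut (A ∪ B)
  lift {A} a = record
    { X⊆A = p⊆p∪q B ∘ C′.X⊆A a
    ; A⊆V = ∪-lub (V′⊆V ∘ C′.A⊆V a) (A⊆V cut)
    ; A∩Y≡∅ = λ v → [ C′.A∩Y≡∅ a v , A∩Y≡∅ cut v ]′ ∘ x∈p∪q⁻ A B
    ; ∂∩Y≡∅ = λ v → C′.∂∩Y≡∅ a v ∘ ∂-lift⊆ a
    }

  -- Added edges create no boundary vertices: they end in `X` or on `∂ B`, whose vertices already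
  -- have a neighbour in `B`, a part of `A`.
  ∂-restrict⊆ : ∀ {A} → Cut A → B ⊆ A → C′.∂ (A ∩ V′) ⊆ ∂ A
  ∂-restrict⊆ {A} a B⊆A {v} v∈ with C′.∈∂⁻ v∈
  ... | v∈V′ , v∉ , c , c∈ , e = go (edge′⁻ e)
    where
    v∉A : v ∉ A
    v∉A v∈A = v∉ (x∈p∩q⁺ (v∈A , v∈V′))
    go : Edge G c v ⊎ (c ∈ X × v ∈ ∂ B) ⊎ v ∈ X → v ∈ ∂ A
    go (inj₁ e)         = ∈∂⁺ (V′⊆V v∈V′ , v∉A , c , p∩q⊆p A V′ c∈ , e)
    go (inj₂ (inj₂ v∈X)) = contradiction (X⊆A a v∈X) v∉A
    go (inj₂ (inj₁ (_ , v∈∂B))) = let _ , _ , b , b∈B , e = ∈∂⁻ v∈∂B in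
      ∈∂⁺ (V′⊆V v∈V′ , v∉A , b , B⊆A b∈B , e)

  restrict : ∀ {A} → Cut A → B ⊆ A → C′.Cut (A ∩ V′)
  restrict {A} a B⊆A = record
    { X⊆A = ∩-glb (X⊆A a) X⊆V′
    ; A⊆V = p∩q⊆q A V′
    ; A∩Y≡∅ = λ v → A∩Y≡∅ a v ∘ p∩q⊆p A V′
    ; ∂∩Y≡∅ = λ v → ∂∩Y≡∅ a v ∘ ∂-restrict⊆ a B⊆A
    }

  ∂-lift-NR⊆ : ∀ {K} → IsSep G′ X Y K → ∂ (C′.NR K ∪ B) ⊆ K
  ∂-lift-NR⊆ {K} sep = C′.∂NR⊆ K ∘ ∂-lift⊆ (C′.sep⇒cut sep)

  sep′⇒sep : ∀ {K} → IsSep G′ X Y K → IsSep G X Y K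
  sep′⇒sep {K} sep@(K⊆V′ , K∩X , K∩Y , _) =
    cut⇒sep (lift (C′.sep⇒cut sep)) (∂-lift-NR⊆ sep) (V′⊆V ∘ K⊆V′) K∩X K∩Y

  ∂B-smallest : IsSmallestSep G′ X Y (∂ B)
  ∂B-smallest =
    C′.cut⇒sep (restrict cut id) (∂-restrict⊆ cut id) ∂B⊆V′
      (λ v v∈∂ v∈X → ∈∂⇒∉ v∈∂ (X⊆A cut v∈X)) (∂∩Y≡∅ cut) ,
    λ K sep → ≤-trans (least (lift (C′.sep⇒cut sep)) (q⊆p∪q _ B ∘ S⊆B))
                      (p⊆q⇒∣p∣≤∣q∣ (∂-lift-NR⊆ sep))

  -- The lifted cut is no more costly than `B`, so maximality puts the `G′`-side of `K` inside `B`.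
  -- Each vertex of `∂ B` is adjacent to `x₀` in `G′`, hence must lie in `K`.
  ∂B-unique : ∀ K → IsSmallestSep G′ X Y K → K ≡ ∂ B
  ∂B-unique K (sep , K-least) =
    sym (⊆-antisym ∂B⊆K (p⊆q∧∣q∣≤∣p∣⇒q⊆p ∂B⊆K K≤∂B))
    where
    K≤∂B = K-least (∂ B) (proj₁ ∂B-smallest)
    NR⊆B : C′.NR K ⊆ B
    NR⊆B = greatest (lift (C′.sep⇒cut sep)) (q⊆p∪q _ B)
      (≤-trans (p⊆q⇒∣p∣≤∣q∣ (∂-lift-NR⊆ sep)) K≤∂B) ∘ p⊆p∪q B
    ∂B⊆K : ∂ B ⊆ K
    ∂B⊆K v∈∂ = [ (λ v∈NR → contradiction (NR⊆B v∈NR) (∈∂⇒∉ v∈∂)) , C′.∂NR⊆ K ]′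
      (C′.∂-spread (C′.X⊆A (C′.sep⇒cut sep) x₀∈X) (new-edge x₀∈X v∈∂))

  -- Uncrossing puts `B` inside `NR K`, so `NR K` restricts to a cut of `G′`. The boundary of that
  -- cut separates in `G` and lies in `K`, hence is `K` by minimality.
  important′ : ∀ {K} → IsImportantSep G X Y K → S ⊆ NR K → IsImportantSep G′ X Y K
  important′ {K} imp@((sep , minimal) , _) S⊆NR =
    subst (IsImportantSep G′ X Y) ∂′≡K
      (C′.maxCut⇒important (restrict a B⊆A , maximal′)
        λ K′ K′⊆ sep′ → trans
          (minimal K′ (subst (K′ ⊆_) ∂′≡K K′⊆) (sep′⇒sep sep′)) (sym ∂′≡K))
    where
    A = NR K
    a = sep⇒cut sep
    B⊆A : B ⊆ A
    B⊆A = tight⊆maxCut τ (important⇒maxCut imp) S⊆NR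
    ∂′⊆∂ : C′.∂ (A ∩ V′) ⊆ ∂ A
    ∂′⊆∂ = ∂-restrict⊆ a B⊆A
    ∂′≡K : C′.∂ (A ∩ V′) ≡ K
    ∂′≡K = minimal _ (∂NR⊆ K ∘ ∂′⊆∂) (sep′⇒sep (C′.∂-sep (restrict a B⊆A)))
    maximal′ : ∀ {C} → C′.Cut C → A ∩ V′ ⊆ C → ∣ C′.∂ C ∣ ≤ ∣ C′.∂ (A ∩ V′) ∣ → C ⊆ A ∩ V′
    -- The lift `C ∪ B` contains `A`, because every vertex of `A` missing from `V′` lies in `B`;
    -- maximality of `A` in `G` applies to it.
    maximal′ {C} c A∩V′⊆C ∂C≤ = ∩-glb
      (proj₂ (important⇒maxCut imp) (lift c) A⊆C∪B
        (≤-trans (p⊆q⇒∣p∣≤∣q∣ (∂-lift⊆ c)) (≤-trans ∂C≤ (p⊆q⇒∣p∣≤∣q∣ ∂′⊆∂)))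
        ∘ p⊆p∪q B)
      (C′.A⊆V c)
      where
      A⊆C∪B : A ⊆ C ∪ B
      A⊆C∪B {v} v∈A with v ∈? B
      ... | yes v∈B = x∈p∪q⁺ (inj₂ v∈B)
      ... | no  v∉B = x∈p∪q⁺ (inj₁ (A∩V′⊆C (x∈p∩q⁺ (v∈A , ∉B⇒∈V′ (A⊆V a v∈A) v∉B))))

-- Greedy rounds and their iteration

module _ {n : ℕ} (X Y : Subset n) where

  record Instance (G : Graph n) (K N : Subset n) : Set where
    field
      symm      : ∀ u v → Adj G u v ≡ Adj G v u
      X⊆V       : X ⊆ V G
      nbhd      : IsNbhd G X N
      smallest  : IsSmallestSep G X Y N
      unique    : ∀ L → IsSmallestSep G X Y L → L ≡ N
      important : IsImportantSep G X Y K

  -- That the sets of the attribute avoid K makes them disjoint from the neighbourhoods of X in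
  -- all earlier rounds, because those meet the remaining vertices in K only.
  Rated : Graph n → Subset n → Subset n → Set
  Rated G K N = ∃ λ attr → CompoundWitness X Y G attr K ×
    All (λ S → ∀ v → v ∈ S → v ∈ V G × v ∉ K) attr × rank attr + ∣ N ∣ ≤ ∣ K ∣

  module Round {G K N} (I : Instance G K N) (K≢N : K ≢ N) where

    open Instance I
    open Cuts X Y G symm X⊆V

    N-sep   = proj₁ smallest
    N-least = proj₂ smallest
    K-sep   = proj₁ (proj₁ important)
    K-cut   = sep⇒cut K-sep

    N⊆∂X : N ⊆ ∂ X
    N⊆∂X v∈N = ∈∂⁺ (to (nbhd _) v∈N)

    N∖K⊆NR : ∀ {v} → v ∈ N → v ∉ K → v ∈ NR K
    N∖K⊆NR v∈N = neighbour∈NR K-sep (N⊆∂X v∈N)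

    N⊈K : ∃ λ t → t ∈ N × t ∉ K
    N⊈K with any? (λ t → (t ∈? N) ×-dec ¬? (t ∈? K))
    ... | yes p = p
    ... | no ¬p = contradiction (sym (proj₂ (proj₁ important) N N⊆K N-sep)) K≢N
      where
      N⊆K : N ⊆ K
      N⊆K {t} t∈N = decidable-stable (t ∈? K) λ t∉K → ¬p (t , t∈N , t∉K)

    -- Since `∣ N ∣` is the minimum size of a separator, `bound` says that `∣ S ∣` is at most the
    -- cover excess of `S`.
    record Candidate (S B : Subset n) : Set where
      field
        tight : Tight S B
        S⊆N   : S ⊆ N
        S∩K   : Disjoint S K
        bound : ∣ S ∣ + ∣ N ∣ ≤ ∣ ∂ B ∣

    -- The set `NR K` serves as a cut around the enlarged set. The set grows by at most one vertex
    -- and the boundary by at least one, so `bound` persists.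
    extend : ∀ {S B t} → Candidate S B → t ∈ ∂ B → t ∈ N → t ∉ K →
      ∃ λ B′ → Candidate (S ∪ ⁅ t ⁆) B′ × ∣ ∂ B ∣ < ∣ ∂ B′ ∣
    extend {S} {B} {t} c t∈∂B t∈N t∉K =
      let B′ , τ′ , B<B′ = tight-extend tight t∈∂B K-cut λ v∈ → N∖K⊆NR (S⁺⊆N v∈) (S⁺∩K _ v∈)
      in B′ , record
        { tight = τ′
        ; S⊆N   = S⁺⊆N
        ; S∩K   = S⁺∩K
        ; bound = ≤-trans (+-monoˡ-≤ ∣ N ∣ (∣p∪⁅x⁆∣≤1+∣p∣ S t)) (≤-trans (s≤s bound) B<B′)
        } , B<B′
      where
      open Candidate c
      S⁺⊆N : S ∪ ⁅ t ⁆ ⊆ N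
      S⁺⊆N = ∪-lub S⊆N (λ v∈ → subst (_∈ N) (sym (x∈⁅y⁆⇒x≡y t v∈)) t∈N)
      S⁺∩K : Disjoint (S ∪ ⁅ t ⁆) K
      S⁺∩K v v∈ =
        [ S∩K v , (λ v∈t → subst (_∉ K) (sym (x∈⁅y⁆⇒x≡y t v∈t)) t∉K) ]′ (x∈p∪q⁻ S ⁅ t ⁆ v∈)

    Saturated : Set
    Saturated = ∃ λ S → ∃ λ B → Candidate S B × Nonempty S ×
      (∀ {v} → v ∈ ∂ B → v ∈ N → v ∈ K)

    -- The fuel `k` bounds the growth still possible for `∂ B`, which has at most `n` vertices.
    saturateN : ∀ k {S B} → Candidate S B → Nonempty S → n ≤ k + ∣ ∂ B ∣ → Saturated
    enlarge : ∀ k {S B} → Candidate S B → n ≤ k + ∣ ∂ B ∣ →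
      (∃ λ t → t ∈ ∂ B × t ∈ N × t ∉ K) → Saturated

    saturateN k {S} {B} c ne n≤
      with any? (λ v → (v ∈? ∂ B) ×-dec (v ∈? N) ×-dec ¬? (v ∈? K))
    ... | yes p = enlarge k c n≤ p
    ... | no ¬∃ = S , B , c , ne , λ {v} v∈∂ v∈N →
      decidable-stable (v ∈? K) λ v∉K → ¬∃ (v , v∈∂ , v∈N , v∉K)

    enlarge zero c n≤ (t , t∈∂ , t∈N , t∉K) =
      let B′ , _ , B<B′ = extend c t∈∂ t∈N t∉K
      in contradiction (≤-trans B<B′ (∣p∣≤n (∂ B′))) (≤⇒≯ n≤)
    enlarge (suc k) c n≤ (t , t∈∂ , t∈N , t∉K) =
      let B′ , c′ , B<B′ = extend c t∈∂ t∈N t∉K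
      in saturateN k c′ (t , x∈p∪q⁺ (inj₂ (x∈⁅x⁆ t)))
           (≤-trans n≤ (≤-trans (≤-reflexive (sym (+-suc k _))) (+-monoʳ-≤ k B<B′)))

    saturated : Saturated
    saturated =
      let B₀ , τ₀ = tight-exists ⊥ (sep⇒cut N-sep) ⊥⊆
          t , t∈N , t∉K = N⊈K
      -- Initially `∂ B₀` is `N`, so a vertex of `N` outside `K` can be added at once; starting with
      -- `enlarge` makes the final `S` nonempty.
      in enlarge n (c₀ τ₀) (m≤m+n n _) (t , subst (t ∈_) (sym (∂B₀≡N τ₀)) t∈N , t∈N , t∉K)
      where
      module _ {B₀} (τ₀ : Tight ⊥ B₀) where
        B₀-sep : IsSep G X Y (∂ B₀)
        B₀-sep = ∂-sep (Tight.cut τ₀)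
        ∂B₀≡N : ∂ B₀ ≡ N
        ∂B₀≡N = unique (∂ B₀) (B₀-sep , λ L sep →
          ≤-trans (tight-least-sep τ₀ N-sep ⊥⊆) (N-least L sep))
        c₀ : Candidate ⊥ B₀
        c₀ = record
          { tight = τ₀
          ; S⊆N   = ⊥⊆
          ; S∩K   = λ v v∈⊥ → contradiction v∈⊥ ∉⊥
          ; bound = ≤-trans (≤-reflexive (cong (_+ ∣ N ∣) (∣⊥∣≡0 n))) (N-least (∂ B₀) B₀-sep)
          }

    Recursion : Set
    Recursion = ∀ {G′ N′} → Instance G′ K N′ → K ≢ N′ → ∣ N ∣ < ∣ N′ ∣ → Rated G′ K N′

    module _ (recurse : Recursion) {S B : Subset n} (c : Candidate S B) {s} (s∈S : s ∈ S)
             (∂B∩N⊆K : ∀ {v} → v ∈ ∂ B → v ∈ N → v ∈ K) where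

      open Candidate c

      S⊆∂X : S ⊆ ∂ X
      S⊆∂X = N⊆∂X ∘ S⊆N

      S⊆NR : S ⊆ NR K
      S⊆NR v∈S = N∖K⊆NR (S⊆N v∈S) (S∩K _ v∈S)

      -- A neighbour of `S` lies in `NR K` or on its boundary, and both avoid `Y`.
      ceDefined : CEDefined G X Y S
      ceDefined = (λ s → ∈∂⁻ ∘ S⊆∂X) , λ s y s∈S y∈Y e →
        [ (λ y∈NR → A∩Y≡∅ K-cut y y∈NR y∈Y)
        , (λ y∈∂ → ∂∩Y≡∅ K-cut y y∈∂ y∈Y) ]′ (∂-spread (S⊆NR s∈S) e)

      S∖K : ∀ v → v ∈ S → v ∈ V G × v ∉ K
      S∖K v v∈S = ∂⊆V (S⊆∂X v∈S) , S∩K v v∈S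

      ∣N∣<∣∂B∣ : ∣ N ∣ < ∣ ∂ B ∣
      ∣N∣<∣∂B∣ = ≤-trans (+-monoˡ-≤ ∣ N ∣ 0<∣S∣) bound
        where
        0<∣S∣ : 0 < ∣ S ∣
        0<∣S∣ = ≤-trans (≤-reflexive (sym (∣⁅x⁆∣≡1 s)))
          (p⊆q⇒∣p∣≤∣q∣ (λ v∈ → subst (_∈ S) (sym (x∈⁅y⁆⇒x≡y s v∈)) s∈S))

      x₀∈X = proj₁ (proj₂ (proj₂ (proj₂ (∈∂⁻ (S⊆∂X s∈S)))))

      open Projection X Y G symm X⊆V tight x₀∈X

      -- A surviving vertex of `N` is adjacent to `B` but outside it, hence on `∂ B`, where the
      -- stopping rule puts it in `K`.
      V′∩N⊆K : ∀ {v} → v ∈ V′ → v ∈ N → v ∈ K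
      V′∩N⊆K {v} v∈V′ v∈N =
        let _ , v∉X , x , x∈X , e = to (nbhd v) v∈N
        in [ (λ v∈B → contradiction v∈B (∈V′⇒∉B v∈V′ v∉X)) , (λ v∈∂ → ∂B∩N⊆K v∈∂ v∈N) ]′
             (∂-spread (X⊆A (Tight.cut tight) x∈X) e)

      N∩T≡∅ : ∀ {T} → (∀ v → v ∈ T → v ∈ V′ × v ∉ K) → Disjoint N T
      N∩T≡∅ T∖K v v∈N v∈T = let v∈V′ , v∉K = T∖K v v∈T in v∉K (V′∩N⊆K v∈V′ v∈N)

      instance′ : Instance G′ K (∂ B)
      instance′ = record
        { symm      = symm′
        ; X⊆V       = X⊆V′
        ; nbhd      = ∂B-nbhd
        ; smallest  = ∂B-smallest
        ; unique    = ∂B-unique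
        ; important = important′ important S⊆NR
        }

      witness : IsImportantWitness G X Y S (∂ B)
      witness = tight⇒importantWitness tight S⊆∂X

      prepend : Rated G′ K (∂ B) → Rated G K N
      prepend (S₂ ∷ Ss , cw , avoid , rank≤) = S ∷ S₂ ∷ Ss ,
        cons (s , s∈S) (All.map (λ T∖K v → N∩T≡∅ T∖K v ∘ S⊆N) avoid) ceDefined witness nbhd
          (All.map N∩T≡∅ avoid) isPrVerts cw ,
        S∖K ∷ All.map (λ T∖K v → map₁ V′⊆V ∘ T∖K v) avoid ,
        (begin
          ∣ S ∣ + ρ + ∣ N ∣    ≡⟨ cong (_+ ∣ N ∣) (+-comm ∣ S ∣ ρ) ⟩
          ρ + ∣ S ∣ + ∣ N ∣    ≡⟨ +-assoc ρ ∣ S ∣ ∣ N ∣ ⟩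
          -- The sum telescopes, as `∂ B` takes the place of `N` in the next round.
          ρ + (∣ S ∣ + ∣ N ∣)  ≤⟨ +-monoʳ-≤ ρ bound ⟩
          ρ + ∣ ∂ B ∣          ≤⟨ rank≤ ⟩
          ∣ K ∣                ∎)
        where
        open ≤-Reasoning
        ρ = rank (S₂ ∷ Ss)

      conclude : Dec (K ≡ ∂ B) → Rated G K N
      conclude (yes K≡∂B) = S ∷ [] ,
        single (s , s∈S) ceDefined (subst (IsImportantWitness G X Y S) (sym K≡∂B) witness) ,
        S∖K ∷ [] ,
        subst₂ _≤_ (cong (_+ ∣ N ∣) (sym (+-identityʳ ∣ S ∣))) (cong ∣_∣ (sym K≡∂B)) bound
      conclude (no K≢∂B) = prepend (recurse instance′ K≢∂B ∣N∣<∣∂B∣)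

    round : Recursion → Rated G K N
    round recurse =
      let S , B , c , (s , s∈S) , ∂B∩N⊆K = saturated
      in conclude recurse c s∈S ∂B∩N⊆K (≡-dec _≟ᵇ_ K (∂ B))

  rated : ∀ m {G K N} → Instance G K N → K ≢ N → ∣ K ∣ ≤ m + ∣ N ∣ → Rated G K N
  -- Without fuel `K` is no larger than `N`, hence a smallest separator, and uniqueness makes it
  -- `N`.
  rated zero {K = K} I K≢N K≤ =
    contradiction (unique K (proj₁ (proj₁ important) , λ L sep →
      ≤-trans K≤ (proj₂ smallest L sep))) K≢N
    where open Instance I
  rated (suc m) {N = N} I K≢N K≤ = Round.round I K≢N λ I′ K≢N′ N<N′ →
    rated m I′ K≢N′
      (≤-trans K≤ (≤-trans (≤-reflexive (sym (+-suc m ∣ N ∣))) (+-monoʳ-≤ m N<N′)))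

theorem15 : ∀ {n} (G : Graph n) (X Y K N : Subset n) →
    IsSimple G → X ⊆ V G → Y ⊆ V G → Disjoint X Y →
    IsNormalized G X Y → IsNbhd G X N →
    IsImportantSep G X Y K → ¬ (K ≡ N) →
    ∃ λ (attr : List (Subset n)) → CompoundWitness X Y G attr K ×
    ∃ λ (r : ℕ) → MinSepSize G X Y r × rank attr + r ≤ ∣ K ∣
theorem15 G X Y K N (symm , _) X⊆V _ _ (N′ , nbhd′ , smallest , unique) nbhd important K≢N =
  let attr , cw , _ , rank≤ = rated X Y ∣ K ∣ I (K≢N ∘ λ K≡N′ → trans K≡N′ N′≡N)
                                (m≤m+n ∣ K ∣ ∣ N′ ∣)
  in attr , cw , ∣ N′ ∣ , (N′ , smallest , refl) , rank≤
  where
  I : Instance X Y G K N′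
  I = record { symm = symm ; X⊆V = X⊆V ; nbhd = nbhd′
             ; smallest = smallest ; unique = unique ; important = important }
  N′≡N : N′ ≡ N
  N′≡N = ⊆-antisym (λ {v} v∈N′ → from (nbhd v) (to (nbhd′ v) v∈N′))
                   (λ {v} v∈N → from (nbhd′ v) (to (nbhd v) v∈N))
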